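{- Let $n_3,k\in\mathbb{N}$. If $k\ge 2$, then $P_3\square P_3\square P_{n_3}$ is equitably $k$-list arborable.
   Context: $P_n$ denotes the path on $n$ vertices and $\square$ the Cartesian product. A $k$-uniform list assignment $L$ for $G$ assigns to each vertex $v$ a set $L(v)$ of exactly $k$ colours; an $L$-colouring is a map $c$ with $c(v)\in L(v)$; it is equitable if every colour class has at most $\lceil |V(G)|/k\rceil$ vertices. $G$ is equitably $k$-list arborable if for every $k$-uniform list assignment $L$ there is an equitable $L$-colouring of $G$ in which every colour class induces an acyclic subgraph. -}

module Defs where

open import Data.Nat using (ℕ; suc; _+_; _*_; _∸_; _≤_; NonZero)
open import Data.Nat.DivMod using (_/_)
open import Data.Fin using (Fin; toℕ)
open import Data.Product using (_×_; _,_; Σ; ∃)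
open import Data.Sum using (_⊎_)
open import Data.List using (List; []; _∷_; length; filter; cartesianProduct; allFin; map)
open import Data.List.Membership.Propositional using (_∈_)
open import Data.List.Relation.Unary.Unique.Propositional using (Unique)
open import Data.List.Relation.Unary.All using (All)
open import Relation.Binary.PropositionalEquality using (_≡_)
open import Relation.Nullary using (¬_)
open import Relation.Unary using (Decidable)

-- Ceiling division ⌈ m / k ⌉ for k ≠ 0 (value at k = 0 is irrelevant: set to 0).
⌈_/_⌉ : (m k : ℕ) → ℕ
⌈ m / 0 ⌉ = 0
⌈ m / suc k ⌉ = (m + suc k ∸ 1) / suc k

data Walk {V : Set} (Adj : V → V → Set) : V → List V → Set where
  [_]  : ∀ v → Walk Adj v (v ∷ [])
  _∷ʷ_ : ∀ {u v vs} → Adj u v → Walk Adj v (v ∷ vs) → Walk Adj u (u ∷ v ∷ vs)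

record Cycle {V : Set} (Adj : V → V → Set) : Set where
  field
    start    : V
    vertices : List V
    walk     : Walk Adj start vertices
    distinct : Unique vertices
    long     : 3 ≤ length vertices
    last     : V
    lastIsEnd : ∃ λ pre → vertices ≡ Data.List._++_ pre (last ∷ [])
    closes   : Adj last start

InducesAcyclic : {V : Set} (Adj : V → V → Set) (S : V → Set) → Set
InducesAcyclic Adj S = (C : Cycle Adj) → ¬ All S (Cycle.vertices C)

PathAdj : (m : ℕ) → Fin m → Fin m → Set
PathAdj m i j = (suc (toℕ i) ≡ toℕ j) ⊎ (suc (toℕ j) ≡ toℕ i)

Vtx : ℕ → ℕ → ℕ → Set
Vtx a b c = Fin a × Fin b × Fin c

BoxAdj : (a b c : ℕ) → Vtx a b c → Vtx a b c → Set
BoxAdj a b c (x , y , z) (x' , y' , z') =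
    (PathAdj a x x' × y ≡ y' × z ≡ z')
  ⊎ (x ≡ x' × PathAdj b y y' × z ≡ z')
  ⊎ (x ≡ x' × y ≡ y' × PathAdj c z z')

vertexList : (a b c : ℕ) → List (Vtx a b c)
vertexList a b c = cartesianProduct (allFin a) (cartesianProduct (allFin b) (allFin c))

UniformListAssignment : (V : Set) → ℕ → (V → List ℕ) → Set
UniformListAssignment V k L = ∀ v → Unique (L v) × length (L v) ≡ k

IsLColouring : {V : Set} → (V → List ℕ) → (V → ℕ) → Set
IsLColouring {V} L c = ∀ (v : V) → c v ∈ L v

classSize : {V : Set} → List V → (V → ℕ) → ℕ → ℕ
classSize vs c α = length (filter (λ v → Data.Nat._≟_ (c v) α) vs)

EquitablyListArborable : (a b c k : ℕ) → Set
EquitablyListArborable a b c k =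
  ∀ (L : Vtx a b c → List ℕ) → UniformListAssignment (Vtx a b c) k L →
  Σ (Vtx a b c → ℕ) λ col →
      IsLColouring L col
    × (∀ α → classSize (vertexList a b c) col α ≤ ⌈ a * b * c / k ⌉)
    × (∀ α → InducesAcyclic (BoxAdj a b c) (λ v → col v ≡ α))

{-# OPTIONS --safe #-}

-- A colour class is acyclic as soon as the vertices carry a rank for which every vertex has at most one
-- neighbour of its own colour of no larger rank: look at a cycle vertex of maximal rank.
--
-- For k ≥ 3, list the vertices layer by layer in a suitable order of the nine columns and cut the list
-- into consecutive blocks of k vertices that get pairwise distinct colours.  Every vertex has at most three
-- lower neighbours, so choosing greedily works for all but the last vertex of a block to be coloured, which
-- only has one colour left; the order is such that every block contains a vertex with at most one neighbour
-- before the block, and this one is coloured last.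
--
-- For k = 2 and even n > 0 no such order exists: a last block of two vertices would contain a vertex of degree
-- at most 2, but P₃ □ P₃ □ Pₙ has minimum degree 3.  Instead colour the layers from
-- bottom to top.  The centre of a layer gets a colour α other than that of the centre below.  The other
-- eight vertices form a ring, coloured cyclically so that neighbours differ, except that a side
-- vertex above a vertex of colour α must only avoid α: with that it sees its colour neither below nor in
-- the centre, and may agree with the corner before it.  The ring splits into four bichromatic pairs, and
-- consecutive centres are paired as well, which gives equitability.

module Submission where

open import Defs
open import Data.Bool using (true; false)
open import Data.Fin using (Fin; zero; suc; fromℕ<; toℕ; #_; opposite)
open import Data.Fin.Properties using (all?; injective⇒≤; fromℕ<-injective; fromℕ<-toℕ; toℕ-fromℕ<; toℕ-injective; toℕ<n)
  renaming (_≟_ to _≟ᶠ_)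
open import Data.List using (List; []; _∷_; _++_; length; filter; map; lookup; upTo)
open import Data.List.Extrema.Nat using (argmax; argmax-all; f[xs]≤f[argmax])
open import Data.List.Membership.Propositional using (_∈_; _∉_)
open import Data.List.Membership.Propositional.Properties
  using (∈-lookup; ∈-filter⁺; ∈-filter⁻; ∈-++⁺ʳ; ∈-map⁺; ∈-upTo⁺)
open import Data.List.Properties using (∷-injectiveʳ; length-++; length-filter; length-map; length-upTo;
  filter-++; filter-accept; filter-reject; filter-some; filter-none; filter-notAll; map-cong; map-∘)
open import Data.List.Relation.Unary.All as All using (All; []; _∷_)
import Data.List.Relation.Unary.All.Properties as All
open import Data.List.Relation.Unary.AllPairs using ([]; _∷_)
open import Data.List.Relation.Unary.Any as Any using (here; there)
open import Data.List.Relation.Unary.Unique.Propositional using (Unique)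
open import Data.List.Relation.Unary.Unique.Propositional.Properties
  using (allFin⁺; cartesianProduct⁺; filter⁺; map⁺; upTo⁺)
open import Data.Nat using (ℕ; zero; suc; _+_; _*_; _∸_; _≤_; _<_; z≤n; s≤s; s≤s⁻¹; NonZero; _≟_; _≤?_; _<?_;
  ⌊_/2⌋; ⌈_/2⌉)
open import Data.Nat.Divisibility using (_∣_; divides; ∣m+n∣m⇒∣n; n∣m*n; ∣-trans; _∣?_)
open import Data.Nat.DivMod using (_/_; _%_; m≡m%n+[m/n]*n; [m+kn]%n≡m%n; m%n<n;
  m<n⇒m%n≡m; m/n*n≤m; m<n*o⇒m/o<n; m*n/n≡m; /-monoˡ-≤)
open import Data.Nat.Properties
open import Data.Product using (_×_; _,_; ∃; ∃-syntax; proj₁; proj₂)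
open import Data.Product.Properties using (≡-dec)
open import Data.Sum as Sum using (_⊎_; inj₁; inj₂; [_,_]′)
open import Function using (_∘_; id)
open import Relation.Binary.PropositionalEquality
open import Relation.Nullary using (¬_; does; Dec; yes; no; ¬?; contradiction; _×-dec_; _⊎-dec_; _→-dec_)
open import Relation.Nullary.Decidable using (decidable-stable; from-no; from-yes; map′)
open import Relation.Unary using (Decidable)

-- Rare colours

count : ℕ → List ℕ → ℕ
count c M = length (filter (_≟ c) M)

-- With `M` the colours of a vertex's lower neighbours, rarity of its own colour is the forest
-- condition. Multiplicity matters: two neighbours of one colour are two occurrences.
Rare : ℕ → List ℕ → Set
Rare c M = count c M ≤ 1

count-≢ : ∀ {c x} M → x ≢ c → count c (x ∷ M) ≡ count c M
count-≢ {c} M x≢c = cong length (filter-reject (_≟ c) x≢c)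

count-≡ : ∀ c M → count c (c ∷ M) ≡ suc (count c M)
count-≡ c M = cong length (filter-accept (_≟ c) refl)

count≤1+ : ∀ c x M → count c (x ∷ M) ≤ suc (count c M)
count≤1+ c x M with does (x ≟ c)
... | true  = ≤-refl
... | false = n≤1+n _

count≤count-∷ : ∀ c x M → count c M ≤ count c (x ∷ M)
count≤count-∷ c x M with does (x ≟ c)
... | true  = n≤1+n _
... | false = ≤-refl

count-++ : ∀ c M N → count c (M ++ N) ≡ count c M + count c N
count-++ c M N = trans (cong length (filter-++ (_≟ c) M N)) (length-++ (filter (_≟ c) M))

count-∉ : ∀ {c} M → All (_≢ c) M → count c M ≡ 0
count-∉ []      []         = refl
count-∉ (x ∷ M) (x≢c ∷ ne) = trans (count-≢ M x≢c) (count-∉ M ne)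

rare-skip : ∀ {c x} M → x ≢ c → Rare c M → Rare c (x ∷ M)
rare-skip M x≢c = subst (_≤ 1) (sym (count-≢ M x≢c))

rare-head : ∀ {c x M} → All (_≢ c) M → Rare c (x ∷ M)
rare-head {c} {x} {M} ne = ≤-trans (count≤1+ c x M) (s≤s (≤-reflexive (count-∉ M ne)))

rare-tail : ∀ {c} x M → Rare c (x ∷ M) → Rare c M
rare-tail x M = ≤-trans (count≤count-∷ _ x M)

rare-∷⇒∉ : ∀ {c x} M → Rare c (x ∷ M) → x ≡ c → c ∉ M
rare-∷⇒∉ {c} M r refl c∈M =
  <⇒≱ (filter-some (_≟ c) (Any.map sym c∈M)) (s≤s⁻¹ (subst (_≤ 1) (count-≡ c M) r))

-- Turns the bound on occurrences into uniqueness of the neighbour with a given colour.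
rare-map⇒≡ : ∀ {A : Set} (f : A → ℕ) {c} xs → Rare c (map f xs) →
             ∀ {u w} → u ∈ xs → w ∈ xs → f u ≡ c → f w ≡ c → u ≡ w
rare-map⇒≡ f (x ∷ xs) r (here refl) (here refl) _ _ = refl
rare-map⇒≡ f (x ∷ xs) r (here refl) (there w∈) refl fw≡c =
  contradiction (subst (_∈ map f xs) fw≡c (∈-map⁺ f w∈)) (rare-∷⇒∉ (map f xs) r refl)
rare-map⇒≡ f (x ∷ xs) r (there u∈) (here refl) fu≡c refl =
  contradiction (subst (_∈ map f xs) fu≡c (∈-map⁺ f u∈)) (rare-∷⇒∉ (map f xs) r refl)
rare-map⇒≡ f (x ∷ xs) r (there u∈) (there w∈) eu ew =
  rare-map⇒≡ f xs (rare-tail (f x) (map f xs) r) u∈ w∈ eu ew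

without : ℕ → List ℕ → List ℕ
without c = filter (¬? ∘ (_≟ c))

length-without : ∀ c M → length M ≡ count c M + length (without c M)
length-without c []      = refl
length-without c (x ∷ M) with does (x ≟ c)
... | true  = cong suc (length-without c M)
... | false = trans (cong suc (length-without c M)) (sym (+-suc (count c M) _))

count-∷-cong : ∀ c x {M N} → count c M ≡ count c N → count c (x ∷ M) ≡ count c (x ∷ N)
count-∷-cong c x eq with does (x ≟ c)
... | true  = cong suc eq
... | false = eq

count-without : ∀ {c d} → d ≢ c → ∀ M → count d (without c M) ≡ count d M
count-without         d≢c []      = refl
count-without {c} {d} d≢c (x ∷ M) with x ≟ c
... | yes refl = trans (cong (count d) (filter-reject (¬? ∘ (_≟ c)) (λ c≢c → c≢c refl)))
                       (trans (count-without d≢c M) (sym (count-≢ M (≢-sym d≢c))))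
... | no x≢c   = trans (cong (count d) (filter-accept (¬? ∘ (_≟ c)) x≢c))
                       (count-∷-cong d x (count-without d≢c M))

-- If every colour of `L` occurred twice in `M`, then `M` would have at least `2 * length L`
-- entries. A frequent head colour is struck from both lists, which costs `M` at least two entries.
rare-element : ∀ L → Unique L → ∀ M → length M < 2 * length L → ∃[ c ] c ∈ L × Rare c M
rare-element (c ∷ L) (c∉L ∷ uL) M lt with count c M ≤? 1
... | yes r = c , here refl , r
... | no ¬r =
  let d , d∈L , r = rare-element L uL (without c M) shorter
  in d , there d∈L , subst (_≤ 1) (count-without (≢-sym (All.lookup c∉L d∈L)) M) r
  where
  open ≤-Reasoning
  shorter : length (without c M) < 2 * length L
  shorter = +-cancelˡ-< 2 _ _ (begin-strict
    2 + length (without c M)         ≤⟨ +-monoˡ-≤ _ (≰⇒> ¬r) ⟩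
    count c M + length (without c M) ≡⟨ length-without c M ⟨
    length M                         <⟨ lt ⟩
    2 * suc (length L)               ≡⟨ *-suc 2 (length L) ⟩
    2 + 2 * length L                 ∎)

-- Listing U twice makes every rare colour avoid U.
rare-element-avoiding : ∀ L → Unique L → ∀ U N → length U + length U + length N < 2 * length L →
                        ∃[ c ] c ∈ L × c ∉ U × Rare c N
rare-element-avoiding L uL U N lt =
  let c , c∈L , r = rare-element L uL ((U ++ U) ++ N) (subst (_< 2 * length L) (sym len) lt)
      r′ : count c U + count c U + count c N ≤ 1
      r′ = subst (_≤ 1) (trans (count-++ c (U ++ U) N) (cong (_+ count c N) (count-++ c U U))) r
  in c , c∈L
   , (λ c∈U → <⇒≱ (<-≤-trans (+-mono-≤ (some c∈U) (some c∈U)) (m≤m+n _ (count c N))) r′)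
   , ≤-trans (m≤n+m _ _) r′
  where
  some : ∀ {c} → c ∈ U → 0 < count c U
  some c∈U = filter-some (_≟ _) (Any.map sym c∈U)
  len : length ((U ++ U) ++ N) ≡ length U + length U + length N
  len = trans (length-++ (U ++ U)) (cong (_+ length N) (length-++ U))

-- Bounding class sizes by block numbers

Unique⇒lookup-injective : ∀ {A : Set} {xs : List A} → Unique xs →
                          ∀ i j → lookup xs i ≡ lookup xs j → i ≡ j
Unique⇒lookup-injective (x∉ ∷ u) Fin.zero    Fin.zero    eq = refl
Unique⇒lookup-injective (x∉ ∷ u) Fin.zero    (Fin.suc j) eq = contradiction eq (All.lookup x∉ (∈-lookup j))
Unique⇒lookup-injective (x∉ ∷ u) (Fin.suc i) Fin.zero    eq = contradiction (sym eq) (All.lookup x∉ (∈-lookup i))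
Unique⇒lookup-injective (x∉ ∷ u) (Fin.suc i) (Fin.suc j) eq = cong Fin.suc (Unique⇒lookup-injective u i j eq)

-- A colour meets each block in at most one vertex, so the block number injects its class into
-- `Fin B`.
classSize-≤ : ∀ {V : Set} {vs : List V} → Unique vs → (col block : V → ℕ) (B : ℕ) →
              (∀ v → block v < B) →
              (∀ v w → block v ≡ block w → col v ≡ col w → v ≡ w) →
              ∀ α → classSize vs col α ≤ B
classSize-≤ {vs = vs} uvs col block B bounded separates α =
  injective⇒≤ {f = λ i → fromℕ< (bounded (lookup class i))} λ {i} {j} eq →
    Unique⇒lookup-injective (filter⁺ (λ v → col v ≟ α) uvs) i j
      (separates _ _ (fromℕ<-injective _ _ (bounded _) (bounded _) eq) (trans (colour i) (sym (colour j))))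
  where
  class = filter (λ v → col v ≟ α) vs
  colour : ∀ i → col (lookup class i) ≡ α
  colour i = proj₂ (∈-filter⁻ (λ v → col v ≟ α) {xs = vs} (∈-lookup {xs = class} i))

<⌈/⌉ : ∀ {t k N} → t * suc k < N → t < ⌈ N / suc k ⌉
<⌈/⌉ {t} {k} {N} lt = begin
  suc t                        ≡⟨ m*n/n≡m (suc t) (suc k) ⟨
  (suc t * suc k) / suc k      ≤⟨ /-monoˡ-≤ (suc k) numerators ⟩
  (N + suc k ∸ 1) / suc k      ∎
  where
  open ≤-Reasoning
  numerators : suc t * suc k ≤ N + suc k ∸ 1
  numerators = begin
    suc k + t * suc k  ≡⟨ +-comm (suc k) (t * suc k) ⟩
    t * suc k + suc k  ≡⟨ +-suc _ k ⟩
    suc (t * suc k) + k ≤⟨ +-monoˡ-≤ k lt ⟩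
    N + k              ≡⟨ +-∸-assoc N {suc k} {1} (s≤s z≤n) ⟨
    N + suc k ∸ 1      ∎

-- Cycles and ranks

module _ {V : Set} {Adj : V → V → Set} (symm : ∀ {u v} → Adj u v → Adj v u) where

  TwoNeighbours : (V → Set) → V → Set
  TwoNeighbours Q x = ∃[ u ] ∃[ w ] Q u × Q w × u ≢ w × Adj x u × Adj x w

  -- Along a walk that is entered from p and left towards s.
  walk⇒twoNeighbours : ∀ (Q : V → Set) {a vs p s l} pre → Walk Adj a vs → vs ≡ pre ++ l ∷ [] → Adj l s →
    Adj p a → Unique (p ∷ vs) → s ∉ vs → p ≢ s ⊎ 2 ≤ length vs → Q p → Q s → All Q vs →
    ∀ {x} → x ∈ vs → TwoNeighbours Q x
  -- The final vertex has `p` and `s` as neighbours. They coincide only when the walk around a whole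
  -- cycle begins, and then at least two vertices remain.
  walk⇒twoNeighbours Q [] [ a ] refl ls pa _ _ (inj₁ p≢s) qp qs _ (here refl) =
    _ , _ , qp , qs , p≢s , symm pa , ls
  walk⇒twoNeighbours Q [] [ a ] refl _ _ _ _ (inj₂ (s≤s ())) _ _ _ _
  walk⇒twoNeighbours Q (_ ∷ []) [ a ] ()
  walk⇒twoNeighbours Q (_ ∷ _ ∷ _) [ a ] ()
  walk⇒twoNeighbours Q pre (ab ∷ʷ W) _ _ pa ((_ ∷ p≢b ∷ _) ∷ _) _ _ qp _ (_ ∷ qb ∷ _) (here refl) =
    _ , _ , qp , qb , p≢b , symm pa , ab
  walk⇒twoNeighbours Q (_ ∷ pre) (ab ∷ʷ W) eq ls pa (_ ∷ u) s∉ _ qp qs (qa ∷ qvs) (there x∈) =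
    walk⇒twoNeighbours Q pre W (∷-injectiveʳ eq) ls ab u (s∉ ∘ there) (inj₁ (λ a≡s → s∉ (here (sym a≡s)))) qa qs qvs x∈

  -- The start is treated apart: its neighbours are the second and the last vertex, distinct because
  -- a cycle has at least three vertices. All others lie on the walk that leaves the start and
  -- returns to it.
  cycle⇒twoNeighbours : ∀ (Q : V → Set) (C : Cycle Adj) → All Q (Cycle.vertices C) →
    ∀ {x} → x ∈ Cycle.vertices C → TwoNeighbours Q x
  cycle⇒twoNeighbours Q C qs x∈ = go (Cycle.walk C) (Cycle.distinct C) (Cycle.long C)
    (proj₁ (Cycle.lastIsEnd C)) (proj₂ (Cycle.lastIsEnd C)) (Cycle.closes C) qs x∈
    where
    go : ∀ {s vs l x} → Walk Adj s vs → Unique vs → 3 ≤ length vs → ∀ pre → vs ≡ pre ++ l ∷ [] →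
         Adj l s → All Q vs → x ∈ vs → TwoNeighbours Q x
    go [ _ ] _ (s≤s ())
    go (_ ∷ʷ [ _ ]) _ (s≤s (s≤s ()))
    go (sb ∷ʷ (bc ∷ʷ W)) (_ ∷ (b∉ ∷ _)) _ (_ ∷ _ ∷ pre) eq ls (qs ∷ qb ∷ qvs) (here refl) =
      let l∈ = subst (_ ∈_) (sym (∷-injectiveʳ (∷-injectiveʳ eq))) (∈-++⁺ʳ pre (here refl))
      in _ , _ , All.lookup qvs l∈ , qb , ≢-sym (All.lookup b∉ l∈) , symm ls , sb
    go (sb ∷ʷ (bc ∷ʷ W)) u@(s∉ ∷ _) (s≤s l≥2) (_ ∷ pre) eq ls (qs ∷ qvs) (there x∈) =
      walk⇒twoNeighbours Q pre (bc ∷ʷ W) (∷-injectiveʳ eq) ls sb u (λ s∈ → All.lookup s∉ s∈ refl)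
        (inj₂ l≥2) qs qs qvs x∈
    go (_ ∷ʷ (_ ∷ʷ _)) _ _ (_ ∷ []) () _ _ (here refl)
    go (_ ∷ʷ (_ ∷ʷ _)) _ _ [] ()

  ranked⇒acyclic : ∀ (S : V → Set) (rank : V → ℕ) →
    (∀ v {u w} → S v → S u → S w → Adj v u → Adj v w → rank u ≤ rank v → rank w ≤ rank v → u ≡ w) →
    InducesAcyclic Adj S
  ranked⇒acyclic S rank unique C inS =
    let top     = argmax rank (Cycle.start C) (Cycle.vertices C)
        top∈    = argmax-all rank {P = _∈ Cycle.vertices C} (start∈ (Cycle.walk C)) (All.tabulate id)
        below   = f[xs]≤f[argmax] {f = rank} (Cycle.start C) (Cycle.vertices C)
        _ , _ , (u≤ , Su) , (w≤ , Sw) , u≢w , tu , tw =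
          cycle⇒twoNeighbours (λ v → rank v ≤ rank top × S v) C (All.zip (below , inS)) top∈
    in u≢w (unique top (All.lookup inS top∈) Su Sw tu tw u≤ w≤)
    where
    start∈ : ∀ {s vs} → Walk Adj s vs → s ∈ vs
    start∈ [ _ ]    = here refl
    start∈ (_ ∷ʷ _) = here refl

-- Layers of P₃ □ P₃ □ Pₙ

Cell : Set
Cell = Fin 3 × Fin 3

LayerAdj : Cell → Cell → Set
LayerAdj (x , y) (x′ , y′) = (PathAdj 3 x x′ × y ≡ y′) ⊎ (x ≡ x′ × PathAdj 3 y y′)

pathAdj? : ∀ (i j : Fin 3) → Dec (PathAdj 3 i j)
pathAdj? i j = (suc (toℕ i) ≟ toℕ j) ⊎-dec (suc (toℕ j) ≟ toℕ i)

layerAdj? : ∀ p q → Dec (LayerAdj p q)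
layerAdj? (x , y) (x′ , y′) = (pathAdj? x x′ ×-dec (y ≟ᶠ y′)) ⊎-dec ((x ≟ᶠ x′) ×-dec pathAdj? y y′)

_≟ᶜ_ : (p q : Cell) → Dec (p ≡ q)
_≟ᶜ_ = ≡-dec _≟ᶠ_ _≟ᶠ_

open import Data.List.Membership.DecPropositional _≟_ using () renaming (_∈?_ to _∈ℕ?_)
open import Data.List.Membership.DecPropositional _≟ᶜ_ using () renaming (_∈?_ to _∈ᶜ?_)
open import Data.List.Membership.DecPropositional (≡-dec _≟ᶜ_ _≟ᶜ_) using () renaming (_∈?_ to _∈²?_)

allCells? : ∀ {Q : Cell → Set} → Decidable Q → Dec (∀ p → Q p)
allCells? Q? = map′ (λ f (x , y) → f x y) (λ f x y → f (x , y)) (all? λ x → all? λ y → Q? (x , y))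

pathAdj-sym : ∀ {m i j} → PathAdj m i j → PathAdj m j i
pathAdj-sym (inj₁ e) = inj₂ e
pathAdj-sym (inj₂ e) = inj₁ e

boxAdj-sym : ∀ {a b c} {u v} → BoxAdj a b c u v → BoxAdj a b c v u
boxAdj-sym (inj₁ (xx , refl , refl))        = inj₁ (pathAdj-sym xx , refl , refl)
boxAdj-sym (inj₂ (inj₁ (refl , yy , refl))) = inj₂ (inj₁ (refl , pathAdj-sym yy , refl))
boxAdj-sym (inj₂ (inj₂ (refl , refl , zz))) = inj₂ (inj₂ (refl , refl , pathAdj-sym zz))

-- c colours the infinite grid P₃ □ P₃ □ ℕ; only its first n layers matter.
record RankedLayers (n : ℕ) (c : ℕ → Cell → ℕ) : Set where
  field
    rank   : ℕ → Cell → ℕ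
    rank-< : ∀ z p → rank z p < rank (suc z) p
    within : ∀ {z} p {q q′} → z < n → LayerAdj p q → LayerAdj p q′ →
             rank z q ≤ rank z p → rank z q′ ≤ rank z p → c z q ≡ c z p → c z q′ ≡ c z p → q ≡ q′
    across : ∀ {z} p {q} → suc z < n → LayerAdj p q → rank (suc z) q ≤ rank (suc z) p →
             c (suc z) q ≡ c (suc z) p → c z p ≢ c (suc z) p

  rankᵛ : Vtx 3 3 n → ℕ
  rankᵛ (x , y , z) = rank (toℕ z) (x , y)

  data LowerNeighbour : Vtx 3 3 n → Vtx 3 3 n → Set where
    inLayer : ∀ {x y x′ y′ z} → LayerAdj (x , y) (x′ , y′) → LowerNeighbour (x , y , z) (x′ , y′ , z)
    under   : ∀ {x y z z′} → suc (toℕ z′) ≡ toℕ z → LowerNeighbour (x , y , z) (x , y , z′)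

  lowerNeighbour : ∀ {v u} → BoxAdj 3 3 n v u → rankᵛ u ≤ rankᵛ v → LowerNeighbour v u
  lowerNeighbour (inj₁ (xx , refl , refl))        _ = inLayer (inj₁ (xx , refl))
  lowerNeighbour (inj₂ (inj₁ (refl , yy , refl))) _ = inLayer (inj₂ (refl , yy))
  lowerNeighbour (inj₂ (inj₂ (refl , refl , inj₂ z′≺z))) _ = under z′≺z
  lowerNeighbour {x , y , z} (inj₂ (inj₂ (refl , refl , inj₁ z≺z′))) u≤v =
    contradiction (subst (λ i → rank i (x , y) ≤ rank (toℕ z) (x , y)) (sym z≺z′) u≤v) (<⇒≱ (rank-< _ _))

  across′ : ∀ {x y x′ y′ z z′} → suc (toℕ z′) ≡ toℕ z → LayerAdj (x , y) (x′ , y′) →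
            rank (toℕ z) (x′ , y′) ≤ rank (toℕ z) (x , y) →
            c (toℕ z) (x′ , y′) ≡ c (toℕ z) (x , y) → c (toℕ {n} z′) (x , y) ≢ c (toℕ {n} z) (x , y)
  across′ {z = z} e with toℕ z | toℕ<n z
  across′ refl | _ | z<n = across _ z<n

  -- A lower neighbour lies in the same layer or directly below, since `rank-<` excludes the one
  -- above. Two in the layer are handled by `within`, one of each kind by `across`, and two below
  -- coincide.
  acyclic : ∀ α → InducesAcyclic (BoxAdj 3 3 n) (λ (x , y , z) → c (toℕ z) (x , y) ≡ α)
  acyclic α = ranked⇒acyclic boxAdj-sym _ rankᵛ λ v cv cu cw vu vw u≤v w≤v →
    unique (lowerNeighbour vu u≤v) (lowerNeighbour vw w≤v) u≤v w≤v (trans cu (sym cv)) (trans cw (sym cv))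
    where
    col : Vtx 3 3 n → ℕ
    col (x , y , z) = c (toℕ z) (x , y)
    unique : ∀ {v u w} → LowerNeighbour v u → LowerNeighbour v w → rankᵛ u ≤ rankᵛ v → rankᵛ w ≤ rankᵛ v →
             col u ≡ col v → col w ≡ col v → u ≡ w
    unique (inLayer pq) (inLayer pq′) u≤v w≤v cu cw with refl ← within _ (toℕ<n _) pq pq′ u≤v w≤v cu cw = refl
    unique (inLayer pq) (under e) u≤v _ cu cw = contradiction cw (across′ e pq u≤v cu)
    unique (under e) (inLayer pq) _ w≤v cu cw = contradiction cu (across′ e pq w≤v cw)
    unique (under e) (under e′) _ _ _ _
      with refl ← toℕ-injective (suc-injective (trans e (sym e′))) = refl

-- A partition of the vertices into at most `B` rainbow blocks, the certificate of equitability.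
record Blocks (n B : ℕ) (c : ℕ → Cell → ℕ) : Set where
  field
    block     : ℕ → Cell → ℕ
    bounded   : ∀ {z} p → z < n → block z p < B
    separates : ∀ {z z′} p q → z < n → z′ < n → block z p ≡ block z′ q → c z p ≡ c z′ q → z ≡ z′ × p ≡ q

-- Beyond the top layer the lists are irrelevant; any k distinct colours serve.
extend : ∀ {n} → ℕ → (Vtx 3 3 n → List ℕ) → ℕ → Cell → List ℕ
extend {n} k L z (x , y) with z <? n
... | yes z<n = L (x , y , fromℕ< z<n)
... | no  _   = upTo k

extend-uniform : ∀ {n} k (L : Vtx 3 3 n → List ℕ) → UniformListAssignment _ k L →
                 ∀ z p → Unique (extend k L z p) × length (extend k L z p) ≡ k
extend-uniform {n} k L uniform z (x , y) with z <? n
... | yes z<n = uniform (x , y , fromℕ< z<n)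
... | no  _   = upTo⁺ k , length-upTo k

extend-toℕ : ∀ {n} k (L : Vtx 3 3 n → List ℕ) x y z → extend k L (toℕ z) (x , y) ≡ L (x , y , z)
extend-toℕ {n} k L x y z with toℕ z <? n
... | yes z<n = cong (λ i → L (x , y , i)) (fromℕ<-toℕ z z<n)
... | no  z≮n = contradiction (toℕ<n z) z≮n

layers⇒arborable : ∀ n k →
  (∀ (L : ℕ → Cell → List ℕ) → (∀ z p → Unique (L z p) × length (L z p) ≡ k) →
    ∃[ c ] (∀ {z} p → z < n → c z p ∈ L z p) × RankedLayers n c × Blocks n ⌈ 3 * 3 * n / k ⌉ c) →
  EquitablyListArborable 3 3 n k
layers⇒arborable n k colour L uniform =
  let c , c∈ , ranked , blocks = colour (extend k L) (extend-uniform k L uniform)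
      open Blocks blocks
  in (λ (x , y , z) → c (toℕ z) (x , y))
   , (λ (x , y , z) → subst (c (toℕ z) (x , y) ∈_) (extend-toℕ k L x y z) (c∈ (x , y) (toℕ<n z)))
   , classSize-≤ (cartesianProduct⁺ (allFin⁺ 3) (cartesianProduct⁺ (allFin⁺ 3) (allFin⁺ n)))
       _ (λ (x , y , z) → block (toℕ z) (x , y)) _
       (λ (x , y , z) → bounded (x , y) (toℕ<n z))
       (λ (x , y , z) (x′ , y′ , z′) eb ec →
         same-vertex (separates (x , y) (x′ , y′) (toℕ<n z) (toℕ<n z′) eb ec))
   , RankedLayers.acyclic ranked
  where
  same-vertex : ∀ {x y z x′ y′ z′} → toℕ z ≡ toℕ z′ × (x , y) ≡ (x′ , y′) → _≡_ {A = Vtx 3 3 n} (x , y , z) (x′ , y′ , z′)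
  same-vertex (ez , refl) with refl ← toℕ-injective ez = refl

-- Numbering by quotient and remainder

[a+z*d]%d≡a : ∀ {a d} .{{_ : NonZero d}} z → a < d → (a + z * d) % d ≡ a
[a+z*d]%d≡a {a} {d} z a<d = trans ([m+kn]%n≡m%n a z d) (m<n⇒m%n≡m a<d)

[a+z*d]/d≡z : ∀ {a d} .{{_ : NonZero d}} z → a < d → (a + z * d) / d ≡ z
[a+z*d]/d≡z {a} {d} z a<d = *-cancelʳ-≡ _ _ d (+-cancelˡ-≡ a _ _
  (trans (cong (_+ (a + z * d) / d * d) (sym ([a+z*d]%d≡a z a<d))) (sym (m≡m%n+[m/n]*n (a + z * d) d))))

a+z*d-injective : ∀ {a a′ d z z′} .{{_ : NonZero d}} → a < d → a′ < d → a + z * d ≡ a′ + z′ * d → z ≡ z′ × a ≡ a′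
a+z*d-injective {d = d} {z} {z′} a<d a′<d e =
    trans (sym ([a+z*d]/d≡z z a<d)) (trans (cong (_/ d) e) ([a+z*d]/d≡z z′ a′<d))
  , trans (sym ([a+z*d]%d≡a z a<d)) (trans (cong (_% d) e) ([a+z*d]%d≡a z′ a′<d))

a+z*d<n*d : ∀ {a d z n} → a < d → z < n → a + z * d < n * d
a+z*d<n*d {a} {d} {z} {n} a<d z<n = begin-strict
  a + z * d <⟨ +-monoˡ-< (z * d) a<d ⟩
  suc z * d ≤⟨ *-monoˡ-≤ d z<n ⟩
  n * d     ∎
  where open ≤-Reasoning

-- Lists of at least three colours

update : (ℕ → ℕ) → ℕ → ℕ → ℕ → ℕ
update d y c i with i ≟ y
... | yes _ = c
... | no  _ = d i

update-≡ : ∀ d y c → update d y c y ≡ c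
update-≡ d y c with y ≟ y
... | yes _  = refl
... | no y≢y = contradiction refl y≢y

update-≢ : ∀ d {y} c {i} → i ≢ y → update d y c i ≡ d i
update-≢ d {y} c {i} i≢y with i ≟ y
... | yes i≡y = contradiction i≡y i≢y
... | no  _   = refl

-- This order of the columns was found by search, to make escape-works below true.
index : Cell → ℕ
index (zero , y) = toℕ y
index (suc zero , zero) = 7
index (suc zero , suc zero) = 5
index (suc zero , suc (suc zero)) = 3
index (suc (suc zero) , zero) = 8
index (suc (suc zero) , suc zero) = 6
index (suc (suc zero) , suc (suc zero)) = 4

unindex : ℕ → Cell
unindex 0 = # 0 , # 0
unindex 1 = # 0 , # 1
unindex 2 = # 0 , # 2
unindex 3 = # 1 , # 2
unindex 4 = # 2 , # 2
unindex 5 = # 1 , # 1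
unindex 6 = # 2 , # 1
unindex 7 = # 1 , # 0
unindex _ = # 2 , # 0

unindex-index : ∀ p → unindex (index p) ≡ p
unindex-index = from-yes (allCells? λ p → unindex (index p) ≟ᶜ p)

index<9 : ∀ p → index p < 9
index<9 = from-yes (allCells? λ p → index p <? 9)

index-injective : ∀ {p q} → index p ≡ index q → p ≡ q
index-injective {p} {q} e = trans (sym (unindex-index p)) (trans (cong unindex e) (unindex-index q))

-- How far back the lower neighbours in the same layer are.
offsets : ℕ → List ℕ
offsets 0 = []
offsets 5 = 4 ∷ 2 ∷ []
offsets 6 = 1 ∷ 2 ∷ []
offsets 7 = 7 ∷ 2 ∷ []
offsets 8 = 1 ∷ 2 ∷ []
offsets _ = 1 ∷ []

offsets-complete : ∀ p q → LayerAdj p q → index q ≤ index p → index p ∸ index q ∈ offsets (index p)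
offsets-complete = from-yes (allCells? λ p → allCells? λ q →
  layerAdj? p q →-dec ((index q ≤? index p) →-dec ((index p ∸ index q) ∈ℕ? offsets (index p))))

length-offsets : ∀ o → length (offsets o) ≤ 2
length-offsets 0 = z≤n
length-offsets 1 = s≤s z≤n
length-offsets 2 = s≤s z≤n
length-offsets 3 = s≤s z≤n
length-offsets 4 = s≤s z≤n
length-offsets 5 = ≤-refl
length-offsets 6 = ≤-refl
length-offsets 7 = ≤-refl
length-offsets 8 = ≤-refl
length-offsets (suc (suc (suc (suc (suc (suc (suc (suc (suc _))))))))) = s≤s z≤n

-- The first entry is the vertex below. In the bottom layer truncation turns it into position 0,
-- which only adds a constraint and keeps the bound of three entries.
back : ℕ → List ℕ
back i = i ∸ 9 ∷ map (i ∸_) (offsets (i % 9))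

position : ℕ → Cell → ℕ
position z p = index p + z * 9

position%9 : ∀ z p → position z p % 9 ≡ index p
position%9 z p = [a+z*d]%d≡a z (index<9 p)

position-injective : ∀ {z z′} p q → position z p ≡ position z′ q → z ≡ z′ × p ≡ q
position-injective p q e =
  let z≡z′ , i≡i′ = a+z*d-injective (index<9 p) (index<9 q) e in z≡z′ , index-injective i≡i′

position< : ∀ {z n} p → z < n → position z p < 9 * n
position< {z} {n} p z<n = subst (position z p <_) (*-comm n 9) (a+z*d<n*d (index<9 p) z<n)

under∈back : ∀ z p → position z p ∈ back (position (suc z) p)
under∈back z p = here (sym (trans (cong (_∸ 9) (trans (+-comm (index p) (9 + z * 9)) (+-assoc 9 (z * 9) (index p))))
  (+-comm (z * 9) (index p))))

inLayer∈back : ∀ z p q → LayerAdj p q → index q ≤ index p → position z q ∈ back (position z p)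
inLayer∈back z p q pq q≤p = there (subst (_∈ map (position z p ∸_) (offsets (position z p % 9))) shift
  (∈-map⁺ (position z p ∸_) (subst (λ o → index p ∸ index q ∈ offsets o) (sym (position%9 z p))
    (offsets-complete p q pq q≤p))))
  where
  shift : position z p ∸ (index p ∸ index q) ≡ position z q
  shift = trans (cong (_∸ (index p ∸ index q)) (+-comm (index p) (z * 9)))
    (trans (+-∸-assoc (z * 9) (m∸n≤m (index p) (index q)))
      (trans (cong (z * 9 +_) (m∸[m∸n]≡n q≤p)) (+-comm (z * 9) (index q))))

length-back : ∀ i → length (back i) ≤ 3
length-back i = s≤s (subst (_≤ 2) (sym (length-map (i ∸_) (offsets (i % 9)))) (length-offsets (i % 9)))

-- For a block starting at `m` only these neighbours can cause conflicts, since colours inside a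
-- block are distinct anyway.
prior : ℕ → ℕ → List ℕ
prior m i = filter (_<? m) (back i)

length-prior : ∀ m i → length (prior m i) ≤ 3
length-prior m i = ≤-trans (length-filter (_<? m) (back i)) (length-back i)

-- Every window of four consecutive positions, and every window of three not starting at 5 modulo 9,
-- contains a position with no neighbour of its own layer before the window.
escape : ℕ → ℕ
escape 0 = 0
escape 1 = 1
escape 2 = 1
escape 3 = 1
escape 4 = 2
escape 5 = 3
escape 6 = 2
escape 7 = 2
escape _ = 1

escape-works : ∀ (r : Fin 9) → escape (toℕ r) < 4 × (toℕ r ≢ 5 → escape (toℕ r) < 3) ×
               All (_≤ escape (toℕ r)) (offsets ((toℕ r + escape (toℕ r)) % 9))
escape-works = from-yes (all? {n = 9} λ r → (escape (toℕ r) <? 4) ×-dec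
  (¬? (toℕ r ≟ 5) →-dec (escape (toℕ r) <? 3)) ×-dec
  All.all? (_≤? escape (toℕ r)) (offsets ((toℕ r + escape (toℕ r)) % 9)))

-- Blocks of three start at multiples of 3, and reduction modulo 9 preserves divisibility by 3, so
-- the exceptional residue never occurs.
3∣⇒%9≢5 : ∀ {m} → 3 ∣ m → m % 9 ≢ 5
3∣⇒%9≢5 {m} 3∣m e = from-no (3 ∣? 5) (subst (3 ∣_) e (∣m+n∣m⇒∣n
  (subst (3 ∣_) (trans (m≡m%n+[m/n]*n m 9) (+-comm (m % 9) _)) 3∣m)
  (∣-trans (divides 3 refl) (n∣m*n (m / 9)))))

-- All neighbours of the escape position within its layer fall inside the block, so at most the
-- vertex below comes before it.
escape-position : ∀ {k m} → 3 ≤ k → (k ≡ 3 → 3 ∣ m) → ∃[ j ] j < k × length (prior m (m + j)) ≤ 1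
escape-position {k} {m} 3≤k 3∣m =
  j , j<k (k ≟ 3) , ≤-trans (length-filter-∷ (m + j ∸ 9) (map (m + j ∸_) (offsets ((m + j) % 9))))
    (s≤s (≤-reflexive (cong length (filter-none (_<? m) late))))
  where
  r = fromℕ< (m%n<n m 9)
  j = escape (toℕ r)
  r≡ : toℕ r ≡ m % 9
  r≡ = toℕ-fromℕ< (m%n<n m 9)
  j<k : Dec (k ≡ 3) → j < k
  j<k (yes refl) = proj₁ (proj₂ (escape-works r)) (subst (_≢ 5) (sym r≡) (3∣⇒%9≢5 (3∣m refl)))
  j<k (no  k≢3)  = ≤-trans (proj₁ (escape-works r)) (≤∧≢⇒< 3≤k (≢-sym k≢3))
  rest : (m + j) % 9 ≡ (toℕ r + j) % 9
  rest = trans (cong (_% 9) (trans (cong (_+ j) (m≡m%n+[m/n]*n m 9))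
           (trans (+-assoc (m % 9) _ j) (trans (cong (m % 9 +_) (+-comm (m / 9 * 9) j)) (sym (+-assoc (m % 9) j _))))))
         (trans ([m+kn]%n≡m%n (m % 9 + j) (m / 9) 9) (cong (λ x → (x + j) % 9) (sym r≡)))
  late : All (λ i → ¬ i < m) (map (m + j ∸_) (offsets ((m + j) % 9)))
  late = All.map⁺ (All.map (λ {d} d≤j → ≤⇒≯ (≤-trans (m≤m+n m (j ∸ d)) (≤-reflexive (sym (+-∸-assoc m d≤j)))))
    (subst (λ o → All (_≤ j) (offsets o)) (sym rest) (proj₂ (proj₂ (escape-works r)))))
  length-filter-∷ : ∀ x xs → length (filter (_<? m) (x ∷ xs)) ≤ suc (length (filter (_<? m) xs))
  length-filter-∷ x xs with does (x <? m)
  ... | true  = ≤-refl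
  ... | false = n≤1+n _

room : ∀ u l {n k} → u + suc l < k → n ≤ 3 → u + u + n < 2 * k
room u l {n} {k} lt n≤3 = begin-strict
  u + u + n         ≤⟨ +-monoʳ-≤ (u + u) n≤3 ⟩
  u + u + 3         ≡⟨ +-comm (u + u) 3 ⟩
  3 + (u + u)       <⟨ n<1+n _ ⟩
  4 + (u + u)       ≡⟨ cong (2 +_) (trans (+-suc u (suc u)) (cong suc (+-suc u u))) ⟨
  (2 + u) + (2 + u) ≤⟨ +-mono-≤ 2+u≤k 2+u≤k ⟩
  k + k             ≡⟨ cong (k +_) (+-identityʳ k) ⟨
  2 * k             ∎
  where
  open ≤-Reasoning
  2+u≤k : 2 + u ≤ k
  2+u≤k = ≤-trans (s≤s (≤-trans (s≤s (m≤m+n u l)) (≤-reflexive (sym (+-suc u l))))) lt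

-- Greedy colouring of a block

module Greedy (k : ℕ) (L : ℕ → List ℕ) (uniform : ∀ i → Unique (L i) × length (L i) ≡ k) where

  pick : ∀ i U N → length U + length U + length N < 2 * k → ∃[ c ] c ∈ L i × c ∉ U × Rare c N
  pick i U N lt = rare-element-avoiding (L i) (proj₁ (uniform i)) U N
    (subst (λ l → length U + length U + length N < 2 * l) (sym (proj₂ (uniform i))) lt)

  -- A system of distinct representatives for the lists of `ys` that avoids the used colours `U`;
  -- `N y` holds the colours of the neighbours of `y` before the block.
  record Transversal (N : ℕ → List ℕ) (U ys : List ℕ) (d : ℕ → ℕ) : Set where
    field
      listed    : ∀ {y} → y ∈ ys → d y ∈ L y
      unused    : ∀ {y} → y ∈ ys → d y ∉ U
      rare      : ∀ {y} → y ∈ ys → Rare (d y) (N y)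
      injective : ∀ {y y′} → y ∈ ys → y′ ∈ ys → d y ≡ d y′ → y ≡ y′

  -- Forbidding `c` to the remaining vertices keeps the representatives distinct.
  transversal-∷ : ∀ {N U y ys c d} → All (y ≢_) ys → c ∈ L y → c ∉ U → Rare c (N y) →
                  Transversal N (c ∷ U) ys d → Transversal N U (y ∷ ys) (update d y c)
  transversal-∷ {N} {U} {y} {ys} {c} {d} y∉ c∈ c∉U c-rare T = record
    { listed    = λ { (here refl) → subst (_∈ L y) (sym d-y) c∈
                    ; (there i∈)  → subst (_∈ L _) (sym (d-ys i∈)) (listed i∈) }
    ; unused    = λ { (here refl) → subst (_∉ U) (sym d-y) c∉U
                    ; (there i∈)  → subst (_∉ U) (sym (d-ys i∈)) (unused i∈ ∘ there) }
    ; rare      = λ { (here refl) → subst (λ a → Rare a (N y)) (sym d-y) c-rare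
                    ; (there i∈)  → subst (λ a → Rare a (N _)) (sym (d-ys i∈)) (rare i∈) }
    ; injective = inj
    }
    where
    open Transversal T
    d-y : update d y c y ≡ c
    d-y = update-≡ d y c
    d-ys : ∀ {i} → i ∈ ys → update d y c i ≡ d i
    d-ys i∈ = update-≢ d c (≢-sym (All.lookup y∉ i∈))
    inj : ∀ {i j} → i ∈ y ∷ ys → j ∈ y ∷ ys → update d y c i ≡ update d y c j → i ≡ j
    inj (here refl) (here refl) _ = refl
    inj (here refl) (there j∈) e = contradiction (here (trans (sym (d-ys j∈)) (trans (sym e) d-y))) (unused j∈)
    inj (there i∈) (here refl) e = contradiction (here (trans (sym (d-ys i∈)) (trans e d-y))) (unused i∈)
    inj (there i∈) (there j∈) e = injective i∈ j∈ (trans (sym (d-ys i∈)) (trans e (d-ys j∈)))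

  greedy : ∀ N → (∀ i → length (N i) ≤ 3) → ∀ U ys → Unique ys → length U + length ys < k →
           ∃ (Transversal N U ys)
  greedy N N≤3 U [] _ _ = (λ _ → 0) , record
    { listed = λ () ; unused = λ () ; rare = λ () ; injective = λ () }
  greedy N N≤3 U (y ∷ ys) (y∉ ∷ uys) lt =
    let c , c∈ , c∉ , c-rare = pick y U (N y) (room (length U) (length ys) lt (N≤3 y))
        d , T = greedy N N≤3 (c ∷ U) ys uys (subst (_< k) (+-suc (length U) (length ys)) lt)
    in update d y c , transversal-∷ y∉ c∈ c∉ c-rare T

  block : ℕ → List ℕ
  block m = map (m +_) (upTo k)

  block-unique : ∀ m → Unique (block m)
  block-unique m = map⁺ (+-cancelˡ-≡ m _ _) (upTo⁺ k)

  length-block : ∀ m → length (block m) ≡ k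
  length-block m = trans (length-map (m +_) (upTo k)) (length-upTo k)

  ∈-block : ∀ {m i} → m ≤ i → i < m + k → i ∈ block m
  ∈-block {m} {i} m≤i i<m+k = subst (_∈ block m) (m+[n∸m]≡n m≤i)
    (∈-map⁺ (m +_) (∈-upTo⁺ (+-cancelˡ-< m _ _ (subst (_< m + k) (sym (m+[n∸m]≡n m≤i)) i<m+k))))

  -- The vertex with at most one neighbour before the block is coloured last.
  blockTransversal : 3 ≤ k → ∀ m → (k ≡ 3 → 3 ∣ m) → (f : ℕ → ℕ) →
                     ∃ (Transversal (map f ∘ prior m) [] (block m))
  blockTransversal 3≤k m 3∣m f =
    let j , j<k , prior≤1 = escape-position 3≤k 3∣m
        s  = m + j
        ys = filter (¬? ∘ (_≟ s)) (block m)
        s∈ : s ∈ block m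
        s∈ = ∈-map⁺ (m +_) (∈-upTo⁺ j<k)
        ys<k : length ys < k
        ys<k = subst (length ys <_) (length-block m)
          (filter-notAll (¬? ∘ (_≟ s)) (block m) (Any.map (λ s≡ ≢s → ≢s (sym s≡)) s∈))
        d , T = greedy (map f ∘ prior m) (λ i → subst (_≤ 3) (sym (length-map f (prior m i))) (length-prior m i))
                  [] ys (filter⁺ (¬? ∘ (_≟ s)) (block-unique m)) ys<k
        -- Up to `k - 1` colours are used, but `2(k - 1) + 1 < 2k`, so one earlier neighbour can be
        -- tolerated.
        c , c∈ , c∉ , c-rare = pick s (map d ys) (map f (prior m s))
          (lastRoom (subst (_< k) (sym (length-map d ys)) ys<k)
                    (subst (_≤ 1) (sym (length-map f (prior m s))) prior≤1))
    in update d s c , swap T c∈ c∉ c-rare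
    where
    lastRoom : ∀ {u n} → u < k → n ≤ 1 → u + u + n < 2 * k
    lastRoom {u} {n} u<k n≤1 = begin-strict
      u + u + n     ≤⟨ +-monoʳ-≤ (u + u) n≤1 ⟩
      u + u + 1     ≡⟨ +-comm (u + u) 1 ⟩
      suc u + u     <⟨ +-mono-≤-< u<k u<k ⟩
      k + k         ≡⟨ cong (k +_) (+-identityʳ k) ⟨
      2 * k         ∎
      where open ≤-Reasoning
    swap : ∀ {s c d} → Transversal (map f ∘ prior m) [] (filter (¬? ∘ (_≟ s)) (block m)) d →
           c ∈ L s → c ∉ map d (filter (¬? ∘ (_≟ s)) (block m)) → Rare c (map f (prior m s)) →
           Transversal (map f ∘ prior m) [] (block m) (update d s c)
    swap {s} {c} {d} T c∈ c∉ c-rare = record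
      { listed    = λ i∈ → Transversal.listed T′ (split i∈)
      ; unused    = λ i∈ → Transversal.unused T′ (split i∈)
      ; rare      = λ i∈ → Transversal.rare T′ (split i∈)
      ; injective = λ i∈ j∈ → Transversal.injective T′ (split i∈) (split j∈)
      }
      where
      ys = filter (¬? ∘ (_≟ s)) (block m)
      split : ∀ {i} → i ∈ block m → i ∈ s ∷ ys
      split {i} i∈ with i ≟ s
      ... | yes i≡s = here i≡s
      ... | no  i≢s = there (∈-filter⁺ (¬? ∘ (_≟ s)) i∈ i≢s)
      T′ : Transversal (map f ∘ prior m) [] (s ∷ ys) (update d s c)
      -- `s` was coloured last but is put in front; the other colours avoid `c` because `c` was
      -- chosen outside them.
      T′ = transversal-∷ (All.tabulate λ i∈ s≡i → proj₂ (∈-filter⁻ (¬? ∘ (_≟ s)) {xs = block m} i∈) (sym s≡i))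
             c∈ (λ ()) c-rare record
               { listed    = Transversal.listed T
               ; unused    = λ { i∈ (here e) → c∉ (subst (_∈ map d ys) e (∈-map⁺ d i∈)) }
               ; rare      = Transversal.rare T
               ; injective = Transversal.injective T
               }

  -- Extending the colouring block by block

  record Valid (m : ℕ) (f : ℕ → ℕ) : Set where
    field
      listed   : ∀ {i} → i < m → f i ∈ L i
      forest   : ∀ {i u w} → i < m → u ∈ back i → w ∈ back i → u < i → w < i → f u ≡ f i → f w ≡ f i → u ≡ w
      distinct : ∀ .{{_ : NonZero k}} {i j} → i < m → j < m → i / k ≡ j / k → f i ≡ f j → i ≡ j

  splice : ℕ → (ℕ → ℕ) → (ℕ → ℕ) → ℕ → ℕ
  splice m f d i with i <? m
  ... | yes _ = f i
  ... | no  _ = d i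

  splice-< : ∀ {m} f d {i} → i < m → splice m f d i ≡ f i
  splice-< {m} f d {i} i<m with i <? m
  ... | yes _   = refl
  ... | no  i≮m = contradiction i<m i≮m

  splice-≥ : ∀ {m} f d {i} → m ≤ i → splice m f d i ≡ d i
  splice-≥ {m} f d {i} m≤i with i <? m
  ... | yes i<m = contradiction i<m (≤⇒≯ m≤i)
  ... | no  _   = refl

  -- A lower neighbour sharing the colour of a new vertex must precede the block, as the block is
  -- rainbow; rarity among the prior neighbours then gives the forest condition.
  valid-step : ∀ t {f d} → Valid (t * k) f → Transversal (map f ∘ prior (t * k)) [] (block (t * k)) d →
               Valid (t * k + k) (splice (t * k) f d)
  valid-step t {f} {d} V T = record { listed = listed′ ; forest = forest′ ; distinct = distinct′ }
    where
    m = t * k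
    g = splice m f d
    module V = Valid V
    module T = Transversal T
    old : ∀ {i} → i < m → g i ≡ f i
    old = splice-< f d
    new : ∀ {i} → m ≤ i → g i ≡ d i
    new = splice-≥ f d
    inBlock : ∀ {i j} → m ≤ i → m ≤ j → i < m + k → j < m + k → g i ≡ g j → i ≡ j
    inBlock m≤i m≤j i< j< e = T.injective (∈-block m≤i i<) (∈-block m≤j j<)
      (trans (sym (new m≤i)) (trans e (new m≤j)))
    listed′ : ∀ {i} → i < m + k → g i ∈ L i
    listed′ {i} i< with i <? m
    ... | yes i<m = V.listed i<m
    ... | no  i≮m = T.listed (∈-block (≮⇒≥ i≮m) i<)
    earlier : ∀ {i u} → m ≤ i → i < m + k → u < i → g u ≡ g i → u < m
    earlier {i} {u} m≤i i< u<i e =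
      [ id , (λ m≤u → contradiction (inBlock m≤u m≤i (<-trans u<i i<) i< e) (<⇒≢ u<i)) ]′ (<-≤-connex u m)
    forest′ : ∀ {i u w} → i < m + k → u ∈ back i → w ∈ back i → u < i → w < i → g u ≡ g i → g w ≡ g i → u ≡ w
    forest′ {i} {u} {w} i< u∈ w∈ u<i w<i eu ew = by-age (i <? m)
      where
      by-age : Dec (i < m) → u ≡ w
      by-age (yes i<m) = V.forest i<m u∈ w∈ u<i w<i
        (trans (sym (old (<-trans u<i i<m))) (trans eu (old i<m)))
        (trans (sym (old (<-trans w<i i<m))) (trans ew (old i<m)))
      by-age (no i≮m) =
        let m≤i = ≮⇒≥ i≮m
            u<m = earlier m≤i i< u<i eu
            w<m = earlier m≤i i< w<i ew
        in rare-map⇒≡ f (prior m i) (T.rare (∈-block m≤i i<))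
             (∈-filter⁺ (_<? m) u∈ u<m) (∈-filter⁺ (_<? m) w∈ w<m)
             (trans (sym (old u<m)) (trans eu (new m≤i)))
             (trans (sym (old w<m)) (trans ew (new m≤i)))
    distinct′ : ∀ .{{_ : NonZero k}} {i j} → i < m + k → j < m + k → i / k ≡ j / k → g i ≡ g j → i ≡ j
    distinct′ {i} {j} i< j< eb e = by-age (i <? m) (j <? m)
      where
      apart : ∀ {i j} → i < m → m ≤ j → i / k ≢ j / k
      apart {i} {j} i<m m≤j = <⇒≢ (<-≤-trans (m<n*o⇒m/o<n i<m)
        (subst (_≤ j / k) (m*n/n≡m t k) (/-monoˡ-≤ k m≤j)))
      by-age : Dec (i < m) → Dec (j < m) → i ≡ j
      by-age (yes i<m) (yes j<m) = V.distinct i<m j<m eb (trans (sym (old i<m)) (trans e (old j<m)))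
      by-age (yes i<m) (no  j≮m) = contradiction eb (apart i<m (≮⇒≥ j≮m))
      by-age (no  i≮m) (yes j<m) = contradiction (sym eb) (apart j<m (≮⇒≥ i≮m))
      by-age (no  i≮m) (no  j≮m) = inBlock (≮⇒≥ i≮m) (≮⇒≥ j≮m) i< j< e

  valid : 3 ≤ k → ∀ t → ∃ (Valid (t * k))
  valid 3≤k zero = (λ _ → 0) , record { listed = λ () ; forest = λ () ; distinct = λ () }
  valid 3≤k (suc t) =
    let f , V = valid 3≤k t
        d , T = blockTransversal 3≤k (t * k) (λ { refl → n∣m*n t }) f
    in splice (t * k) f d , subst (λ m → Valid m (splice (t * k) f d)) (+-comm (t * k) k) (valid-step t V T)

arborable-≥3 : ∀ n k → 3 ≤ k → EquitablyListArborable 3 3 n k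
arborable-≥3 n k@(suc k-1) 3≤k = layers⇒arborable n k λ L uniform →
  let open Greedy k (λ i → L (i / 9) (unindex (i % 9))) (λ i → uniform (i / 9) (unindex (i % 9)))
      -- Since `k ≥ 1`, this many blocks cover all `9 * n` positions; the surplus lies above the top
      -- layer.
      f , V = valid 3≤k (9 * n)
      open Valid V
      bound : ∀ {z} p → z < n → position z p < 9 * n * k
      bound p z<n = <-≤-trans (position< p z<n) (m≤m*n (9 * n) k)
  in (λ z p → f (position z p))
   , (λ {z} p z<n → subst (f (position z p) ∈_)
       (cong₂ L ([a+z*d]/d≡z z (index<9 p)) (trans (cong unindex (position%9 z p)) (unindex-index p)))
       (listed (bound p z<n)))
   , record
     { rank   = position
     ; rank-< = λ z p → +-monoʳ-< (index p) (*-monoˡ-< 9 (n<1+n z))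
     ; within = λ {z} p {q} {q′} z<n pq pq′ q≤p q′≤p eq eq′ → proj₂ (position-injective {z} {z} q q′
         (forest (bound p z<n) (inLayer∈back z p q pq (+-cancelʳ-≤ (z * 9) _ _ q≤p))
           (inLayer∈back z p q′ pq′ (+-cancelʳ-≤ (z * 9) _ _ q′≤p))
           (strict z pq q≤p) (strict z pq′ q′≤p) eq eq′))
     ; across = λ {z} p {q} z<n pq q≤p eq eu → 1+n≢n (proj₁ (position-injective {suc z} {z} q p
         (forest (bound p z<n) (inLayer∈back (suc z) p q pq (+-cancelʳ-≤ (suc z * 9) _ _ q≤p)) (under∈back z p)
           (strict (suc z) pq q≤p) (+-monoʳ-< (index p) (*-monoˡ-< 9 (n<1+n z))) eq eu)))
     }
   , record
     { block     = λ z p → position z p / k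
     ; bounded   = λ {z} p z<n → <⌈/⌉ (≤-<-trans (m/n*n≤m (position z p) k) (position< p z<n))
     ; separates = λ p q z<n z′<n eb ec → position-injective p q (distinct (bound p z<n) (bound q z′<n) eb ec)
     }
  where
  layerAdj-irrefl : ∀ p → ¬ LayerAdj p p
  layerAdj-irrefl p (inj₁ (inj₁ e , _)) = 1+n≢n e
  layerAdj-irrefl p (inj₁ (inj₂ e , _)) = 1+n≢n e
  layerAdj-irrefl p (inj₂ (_ , inj₁ e)) = 1+n≢n e
  layerAdj-irrefl p (inj₂ (_ , inj₂ e)) = 1+n≢n e
  strict : ∀ z {p q} → LayerAdj p q → position z q ≤ position z p → position z q < position z p
  strict z {p} {q} pq q≤p = ≤∧≢⇒< q≤p λ e →
    layerAdj-irrefl p (subst (LayerAdj p) (proj₂ (position-injective {z} {z} q p e)) pq)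

-- Lists of two colours

rare-[x] : ∀ {c} x → Rare c (x ∷ [])
rare-[x] x = rare-head {x = x} []

rare-distinct : ∀ {c x y} → x ≢ y → Rare c (x ∷ y ∷ [])
rare-distinct {c} {x} {y} x≢y with x ≟ c
... | yes refl = rare-head {x = x} (≢-sym x≢y ∷ [])
... | no  x≢c  = rare-skip (y ∷ []) x≢c (rare-[x] y)

avoiding : ∀ {L} → Unique L × length L ≡ 2 → ∀ x → ∃[ d ] d ∈ L × x ≢ d
avoiding {L} (uL , |L|≡2) x =
  let d , d∈ , d∉ , _ = rare-element-avoiding L uL (x ∷ []) [] (subst (λ l → 2 < 2 * l) (sym |L|≡2) (s≤s (s≤s (s≤s z≤n))))
  in d , d∈ , λ x≡d → d∉ (here (sym x≡d))

-- A side vertex sees the colour b below it, the centre colour α, and the colour e of the preceding corner.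
sideColour : ∀ {L} → Unique L × length L ≡ 2 → ∀ b α e →
             ∃[ d ] d ∈ L × Rare d (b ∷ α ∷ e ∷ []) × (b ≢ α → e ≢ d)
sideColour two b α e with b ≟ α
-- Avoiding `α` removes two occurrences at once and leaves only `e`. In the other case `e` is
-- avoided, and the distinct `b` and `α` cannot both equal `d`.
... | yes refl = let d , d∈ , α≢d = avoiding two α in
  d , d∈ , rare-skip (α ∷ e ∷ []) α≢d (rare-skip (e ∷ []) α≢d (rare-[x] e)) , contradiction refl
... | no b≢α = let d , d∈ , e≢d = avoiding two e in
  d , d∈ , rare d e≢d , λ _ → e≢d
  where
  rare : ∀ d → e ≢ d → Rare d (b ∷ α ∷ e ∷ [])
  rare d e≢d with b ≟ d
  ... | yes refl = rare-head {x = b} (≢-sym b≢α ∷ e≢d ∷ [])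
  ... | no  b≢d  = rare-skip (α ∷ e ∷ []) b≢d (rare-head {x = α} (e≢d ∷ []))

-- Colouring one layer: centre `m`, and the ring `s₁ c₁ s₂ c₂ s₃ c₃ s₄ c₄` of sides and corners in
-- cyclic order

m s₁ s₂ s₃ s₄ c₁ c₂ c₃ c₄ : Cell
m  = # 1 , # 1
s₁ = # 0 , # 1
c₁ = # 0 , # 2
s₂ = # 1 , # 2
c₂ = # 2 , # 2
s₃ = # 2 , # 1
c₃ = # 2 , # 0
s₄ = # 1 , # 0
c₄ = # 0 , # 0

onLayer : ∀ {Q : Cell → Set} → Q m → Q s₁ → Q c₁ → Q s₂ → Q c₂ → Q s₃ → Q c₃ → Q s₄ → Q c₄ → ∀ p → Q p
onLayer a b c d e f g h i (zero , zero) = i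
onLayer a b c d e f g h i (zero , suc zero) = b
onLayer a b c d e f g h i (zero , suc (suc zero)) = c
onLayer a b c d e f g h i (suc zero , zero) = h
onLayer a b c d e f g h i (suc zero , suc zero) = a
onLayer a b c d e f g h i (suc zero , suc (suc zero)) = d
onLayer a b c d e f g h i (suc (suc zero) , zero) = g
onLayer a b c d e f g h i (suc (suc zero) , suc zero) = f
onLayer a b c d e f g h i (suc (suc zero) , suc (suc zero)) = e

-- `b` colours the layer below and `α` is the colour of the centre. In `rare` the vertex below
-- counts as a further lower neighbour. `pair` splits the ring only; centres are paired across
-- layers.
record LayerColouring (L : Cell → List ℕ) (b : Cell → ℕ) (α : ℕ) : Set where
  field
    col          : Cell → ℕ
    col∈         : ∀ p → col p ∈ L p
    col-m        : col m ≡ α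
    rank         : Cell → ℕ
    rank<9       : ∀ p → rank p < 9
    low          : Cell → List Cell
    low-complete : ∀ p q → LayerAdj p q → rank q ≤ rank p → q ∈ low p
    rare         : ∀ p → Rare (col p) (b p ∷ map col (low p))
    pair         : Cell → ℕ
    pair<4       : ∀ p → p ≢ m → pair p < 4
    paired       : ∀ p q → p ≢ m → pair p ≡ pair q → p ≢ q → col p ≢ col q

-- The quarter turn about `m`, taking `s₁` to `s₂` and so on around the ring.
ρ ρ⁻¹ : Cell → Cell
ρ   (x , y) = y , opposite x
ρ⁻¹ (x , y) = opposite y , x

ρ∘ρ⁻¹ : ∀ p → ρ (ρ⁻¹ p) ≡ p
ρ∘ρ⁻¹ = from-yes (allCells? λ p → ρ (ρ⁻¹ p) ≟ᶜ p)

ρ⁻¹∘ρ : ∀ p → ρ⁻¹ (ρ p) ≡ p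
ρ⁻¹∘ρ = from-yes (allCells? λ p → ρ⁻¹ (ρ p) ≟ᶜ p)

ρ⁻¹-adj : ∀ p q → LayerAdj p q → LayerAdj (ρ⁻¹ p) (ρ⁻¹ q)
ρ⁻¹-adj = from-yes (allCells? λ p → allCells? λ q → layerAdj? p q →-dec layerAdj? (ρ⁻¹ p) (ρ⁻¹ q))

ρ⁻¹-≢m : ∀ p → p ≢ m → ρ⁻¹ p ≢ m
ρ⁻¹-≢m = from-yes (allCells? λ p → ¬? (p ≟ᶜ m) →-dec ¬? (ρ⁻¹ p ≟ᶜ m))

-- By this symmetry a side vertex above colour `α` may be assumed to be `s₁`.
unrotate : ∀ {L b α} → LayerColouring (L ∘ ρ) (b ∘ ρ) α → LayerColouring L b α
unrotate {L} {b} S = record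
  { col          = col ∘ ρ⁻¹
  ; col∈         = λ p → subst (λ q → col (ρ⁻¹ p) ∈ L q) (ρ∘ρ⁻¹ p) (col∈ (ρ⁻¹ p))
  ; col-m        = col-m
  ; rank         = rank ∘ ρ⁻¹
  ; rank<9       = rank<9 ∘ ρ⁻¹
  ; low          = λ p → map ρ (low (ρ⁻¹ p))
  ; low-complete = λ p q pq q≤p → subst (_∈ map ρ (low (ρ⁻¹ p))) (ρ∘ρ⁻¹ q)
                     (∈-map⁺ ρ (low-complete (ρ⁻¹ p) (ρ⁻¹ q) (ρ⁻¹-adj p q pq) q≤p))
  ; rare         = λ p → subst₂ (λ x xs → Rare (col (ρ⁻¹ p)) (x ∷ xs)) (cong b (ρ∘ρ⁻¹ p))
                     (trans (map-cong (λ q → cong col (sym (ρ⁻¹∘ρ q))) (low (ρ⁻¹ p))) (map-∘ (low (ρ⁻¹ p))))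
                     (rare (ρ⁻¹ p))
  ; pair         = pair ∘ ρ⁻¹
  ; pair<4       = λ p p≢m → pair<4 (ρ⁻¹ p) (ρ⁻¹-≢m p p≢m)
  ; paired       = λ p q p≢m e p≢q → paired (ρ⁻¹ p) (ρ⁻¹ q) (ρ⁻¹-≢m p p≢m) e
                     (λ e′ → p≢q (trans (sym (ρ∘ρ⁻¹ p)) (trans (cong ρ e′) (ρ∘ρ⁻¹ q))))
  }
  where open LayerColouring S

apart : ∀ {col : Cell → ℕ} {pairs} → All (λ (p , q) → col p ≢ col q) pairs →
        ∀ {p q} → (p , q) ∈ pairs ⊎ (q , p) ∈ pairs → col p ≢ col q
apart ne = [ All.lookup ne , (λ qp → ≢-sym (All.lookup ne qp)) ]′

module _ {L : Cell → List ℕ} (two : ∀ p → Unique (L p) × length (L p) ≡ 2) (b : Cell → ℕ) {α} (α∈ : α ∈ L m) where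

  private
    side : ∀ s e → ∃[ d ] d ∈ L s × Rare d (b s ∷ α ∷ e ∷ []) × (b s ≢ α → e ≢ d)
    side s = sideColour (two s) (b s) α

  -- Order c₁ s₂ c₂ s₃ c₃ s₄ c₄ s₁; a corner differs from the side before it.
  colourFromSide : b s₁ ≡ α → LayerColouring L b α
  colourFromSide bs₁≡α =
    -- `s₁` ranks last but is coloured first: it avoids the centre and the vertex below, both `α`,
    -- and `c₁` will avoid it, so only `c₄` can agree with it.
    let d₁ , d₁∈ , α≢d₁      = avoiding (two s₁) α
        e₁ , e₁∈ , d₁≢e₁     = avoiding (two c₁) d₁
        d₂ , d₂∈ , r₂ , _    = side s₂ e₁
        e₂ , e₂∈ , d₂≢e₂     = avoiding (two c₂) d₂
        d₃ , d₃∈ , r₃ , _    = side s₃ e₂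
        e₃ , e₃∈ , d₃≢e₃     = avoiding (two c₃) d₃
        d₄ , d₄∈ , r₄ , _    = side s₄ e₃
        e₄ , e₄∈ , d₄≢e₄     = avoiding (two c₄) d₄
        col = onLayer α d₁ e₁ d₂ e₂ d₃ e₃ d₄ e₄
    in record
    { col    = col
    ; col∈   = onLayer α∈ d₁∈ e₁∈ d₂∈ e₂∈ d₃∈ e₃∈ d₄∈ e₄∈
    ; col-m  = refl
    ; rank   = rank
    ; rank<9 = from-yes (allCells? λ p → rank p <? 9)
    ; low    = low
    ; low-complete = from-yes (allCells? λ p → allCells? λ q → layerAdj? p q →-dec ((rank q ≤? rank p) →-dec (q ∈ᶜ? low p)))
    ; rare   = onLayer (rare-[x] (b m))
        (rare-skip (α ∷ e₄ ∷ e₁ ∷ []) (λ e → α≢d₁ (trans (sym bs₁≡α) e))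
          (rare-skip (e₄ ∷ e₁ ∷ []) α≢d₁ (rare-head {x = e₄} (≢-sym d₁≢e₁ ∷ []))))
        (rare-[x] (b c₁)) r₂ (rare-head {x = b c₂} (d₂≢e₂ ∷ [])) r₃ (rare-head {x = b c₃} (d₃≢e₃ ∷ [])) r₄
        (rare-head {x = b c₄} (d₄≢e₄ ∷ []))
    ; pair   = pair
    ; pair<4 = from-yes (allCells? λ p → ¬? (p ≟ᶜ m) →-dec (pair p <? 4))
    ; paired = λ p q p≢m e p≢q → apart {col} {pairs} (d₁≢e₁ ∷ d₂≢e₂ ∷ d₃≢e₃ ∷ d₄≢e₄ ∷ []) (pairs-complete p q p≢m e p≢q)
    }
    where
    rank pair : Cell → ℕ
    rank = onLayer 0 8 1 2 3 4 5 6 7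
    pair = onLayer 4 0 0 1 1 2 2 3 3
    low : Cell → List Cell
    low = onLayer [] (m ∷ c₄ ∷ c₁ ∷ []) [] (m ∷ c₁ ∷ []) (s₂ ∷ []) (m ∷ c₂ ∷ []) (s₃ ∷ []) (m ∷ c₃ ∷ []) (s₄ ∷ [])
    pairs : List (Cell × Cell)
    pairs = (s₁ , c₁) ∷ (s₂ , c₂) ∷ (s₃ , c₃) ∷ (s₄ , c₄) ∷ []
    pairs-complete : ∀ p q → p ≢ m → pair p ≡ pair q → p ≢ q → (p , q) ∈ pairs ⊎ (q , p) ∈ pairs
    pairs-complete = from-yes (allCells? λ p → allCells? λ q → ¬? (p ≟ᶜ m) →-dec ((pair p ≟ pair q) →-dec
      (¬? (p ≟ᶜ q) →-dec (((p , q) ∈²? pairs) ⊎-dec ((q , p) ∈²? pairs)))))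

  -- Order s₁ c₁ s₂ c₂ s₃ c₃ s₄ c₄; the colours are chosen from c₁ on, and s₁ may agree with c₁.
  colourFromCorner : (∀ {s} → s ∈ s₁ ∷ s₂ ∷ s₃ ∷ s₄ ∷ [] → b s ≢ α) → LayerColouring L b α
  colourFromCorner b≢α =
    -- `s₁` ranks below `c₁` though its colour comes last. Avoiding the vertex below makes `c₁` safe
    -- whatever that colour is.
    let e₁ , e₁∈ , b≢e₁       = avoiding (two c₁) (b c₁)
        d₂ , d₂∈ , r₂ , e₁≢d₂ = side s₂ e₁
        e₂ , e₂∈ , d₂≢e₂      = avoiding (two c₂) d₂
        d₃ , d₃∈ , r₃ , e₂≢d₃ = side s₃ e₂
        e₃ , e₃∈ , d₃≢e₃      = avoiding (two c₃) d₃
        d₄ , d₄∈ , r₄ , e₃≢d₄ = side s₄ e₃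
        e₄ , e₄∈ , d₄≢e₄      = avoiding (two c₄) d₄
        d₁ , d₁∈ , r₁ , e₄≢d₁ = side s₁ e₄
        e₄≢d₁ = e₄≢d₁ (b≢α (here refl))
        col = onLayer α d₁ e₁ d₂ e₂ d₃ e₃ d₄ e₄
    in record
    { col    = col
    ; col∈   = onLayer α∈ d₁∈ e₁∈ d₂∈ e₂∈ d₃∈ e₃∈ d₄∈ e₄∈
    ; col-m  = refl
    ; rank   = rank
    ; rank<9 = from-yes (allCells? λ p → rank p <? 9)
    ; low    = low
    ; low-complete = from-yes (allCells? λ p → allCells? λ q → layerAdj? p q →-dec ((rank q ≤? rank p) →-dec (q ∈ᶜ? low p)))
    ; rare   = onLayer (rare-[x] (b m))
        -- `s₁` has only the centre and the vertex below as lower neighbours; their colours differ,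
        -- so any colour is rare.
        (rare-distinct (b≢α (here refl)))
        (rare-skip (d₁ ∷ []) b≢e₁ (rare-[x] d₁)) r₂ (rare-head {x = b c₂} (d₂≢e₂ ∷ [])) r₃
        (rare-head {x = b c₃} (d₃≢e₃ ∷ [])) r₄ (rare-head {x = b c₄} (d₄≢e₄ ∷ ≢-sym e₄≢d₁ ∷ []))
    ; pair   = pair
    ; pair<4 = from-yes (allCells? λ p → ¬? (p ≟ᶜ m) →-dec (pair p <? 4))
    ; paired = λ p q p≢m e p≢q → apart {col} {pairs}
        (e₁≢d₂ (b≢α (there (here refl))) ∷ e₂≢d₃ (b≢α (there (there (here refl)))) ∷
         e₃≢d₄ (b≢α (there (there (there (here refl))))) ∷ e₄≢d₁ ∷ []) (pairs-complete p q p≢m e p≢q)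
    }
    where
    rank pair : Cell → ℕ
    rank = onLayer 0 1 2 3 4 5 6 7 8
    pair = onLayer 4 3 0 0 1 1 2 2 3
    low : Cell → List Cell
    low = onLayer [] (m ∷ []) (s₁ ∷ []) (m ∷ c₁ ∷ []) (s₂ ∷ []) (m ∷ c₂ ∷ []) (s₃ ∷ []) (m ∷ c₃ ∷ []) (s₄ ∷ s₁ ∷ [])
    pairs : List (Cell × Cell)
    pairs = (c₁ , s₂) ∷ (c₂ , s₃) ∷ (c₃ , s₄) ∷ (c₄ , s₁) ∷ []
    pairs-complete : ∀ p q → p ≢ m → pair p ≡ pair q → p ≢ q → (p , q) ∈ pairs ⊎ (q , p) ∈ pairs
    pairs-complete = from-yes (allCells? λ p → allCells? λ q → ¬? (p ≟ᶜ m) →-dec ((pair p ≟ pair q) →-dec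
      (¬? (p ≟ᶜ q) →-dec (((p , q) ∈²? pairs) ⊎-dec ((q , p) ∈²? pairs)))))

-- A side above colour `α` is a place where the cyclic dependence can be cut. If there is none,
-- every side chosen differs from the preceding corner and the ring closes.
colourLayer : ∀ {L} → (∀ p → Unique (L p) × length (L p) ≡ 2) → ∀ b {α} → α ∈ L m → LayerColouring L b α
colourLayer two b {α} α∈ with b s₁ ≟ α | b s₂ ≟ α | b s₃ ≟ α | b s₄ ≟ α
... | yes e | _ | _ | _ = colourFromSide two b α∈ e
... | no _ | yes e | _ | _ = unrotate (colourFromSide (two ∘ ρ) (b ∘ ρ) α∈ e)
... | no _ | no _ | yes e | _ = unrotate (unrotate (colourFromSide (two ∘ ρ ∘ ρ) (b ∘ ρ ∘ ρ) α∈ e))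
... | no _ | no _ | no _ | yes e =
  unrotate (unrotate (unrotate (colourFromSide (two ∘ ρ ∘ ρ ∘ ρ) (b ∘ ρ ∘ ρ ∘ ρ) α∈ e)))
... | no n₁ | no n₂ | no n₃ | no n₄ = colourFromCorner two b α∈ λ
  { (here refl) → n₁ ; (there (here refl)) → n₂ ; (there (there (here refl))) → n₃
  ; (there (there (there (here refl)))) → n₄ }

-- Centres sharing a block lie in equal or consecutive layers, and consecutive centres have
-- different colours.
⌊/2⌋-collision : ∀ i j → ⌊ i /2⌋ ≡ ⌊ j /2⌋ → i ≡ j ⊎ i ≡ suc j ⊎ suc i ≡ j
⌊/2⌋-collision 0 0 _ = inj₁ refl
⌊/2⌋-collision 0 1 _ = inj₂ (inj₂ refl)
⌊/2⌋-collision 1 0 _ = inj₂ (inj₁ refl)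
⌊/2⌋-collision 1 1 _ = inj₁ refl
⌊/2⌋-collision 0 (suc (suc j)) ()
⌊/2⌋-collision 1 (suc (suc j)) ()
⌊/2⌋-collision (suc (suc i)) 0 ()
⌊/2⌋-collision (suc (suc i)) 1 ()
⌊/2⌋-collision (suc (suc i)) (suc (suc j)) e =
  Sum.map (cong (2 +_)) (Sum.map (cong (2 +_)) (cong (2 +_))) (⌊/2⌋-collision i j (suc-injective e))

-- Stacking the layers

module Layers (L : ℕ → Cell → List ℕ) (two : ∀ z p → Unique (L z p) × length (L z p) ≡ 2) where

  centre : ∀ z (b : Cell → ℕ) → ∃[ α ] α ∈ L z m × b m ≢ α
  centre z b = avoiding (two z m) (b m)

  layer : ∀ z (b : Cell → ℕ) → LayerColouring (L z) b (proj₁ (centre z b))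
  layer z b = colourLayer (two z) b (proj₁ (proj₂ (centre z b)))

  -- An arbitrary layer is imagined below layer 0.
  below colour : ℕ → Cell → ℕ
  below zero    = λ _ → 0
  below (suc z) = colour z
  colour z = LayerColouring.col (layer z (below z))

  module Layer z = LayerColouring (layer z (below z))

  centre-changes : ∀ z → colour z m ≢ colour (suc z) m
  centre-changes z e = proj₂ (proj₂ (centre (suc z) (colour z))) (trans e (Layer.col-m (suc z)))

  -- Ranks in a layer are below 9, so shifting by 9 per layer puts every vertex above the one
  -- beneath it. The tail of `rare` gives `within`, its head gives `across`.
  rankedLayers : ∀ n → RankedLayers n colour
  rankedLayers n = record
    { rank   = λ z p → Layer.rank z p + z * 9
    ; rank-< = λ z p → <-≤-trans (+-monoˡ-< (z * 9) (Layer.rank<9 z p)) (m≤n+m (suc z * 9) (Layer.rank (suc z) p))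
    ; within = λ {z} p {q} {q′} _ pq pq′ q≤p q′≤p eq eq′ →
        rare-map⇒≡ (colour z) (Layer.low z p) (rare-tail (below z p) _ (Layer.rare z p))
          (lower z pq q≤p) (lower z pq′ q′≤p) eq eq′
    ; across = λ {z} p {q} _ pq q≤p eq eu →
        rare-∷⇒∉ (map (colour (suc z)) (Layer.low (suc z) p)) (Layer.rare (suc z) p) eu
          (subst (_∈ map (colour (suc z)) (Layer.low (suc z) p)) eq (∈-map⁺ (colour (suc z)) (lower (suc z) pq q≤p)))
    }
    where
    lower : ∀ z {p q} → LayerAdj p q → Layer.rank z q + z * 9 ≤ Layer.rank z p + z * 9 → q ∈ Layer.low z p
    lower z pq q≤p = Layer.low-complete z _ _ pq (+-cancelʳ-≤ (z * 9) _ _ q≤p)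

  -- Four ring pairs per layer take the numbers below `4n`, and the centres of layers `2i` and
  -- `2i + 1` share a later one: `4n + ⌈n/2⌉ = ⌈9n/2⌉` blocks in all.
  blocks : ∀ n → Blocks n ⌈ 3 * 3 * n / 2 ⌉ colour
  blocks n = record { block = λ z p → block z p (p ≟ᶜ m) ; bounded = λ p → bounded p (p ≟ᶜ m)
                    ; separates = λ p q → separates p q (p ≟ᶜ m) (q ≟ᶜ m) }
    where
    block : ℕ → ∀ p → Dec (p ≡ m) → ℕ
    block z p (yes _) = ⌊ z /2⌋ + n * 4
    block z p (no  _) = Layer.pair z p + z * 4
    ringBlock< : ∀ {z} p → p ≢ m → z < n → Layer.pair z p + z * 4 < n * 4
    ringBlock< {z} p p≢m z<n = a+z*d<n*d (Layer.pair<4 z p p≢m) z<n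
    half : ∀ z → ⌊ z /2⌋ * 2 ≤ z
    half z = begin
      ⌊ z /2⌋ * 2             ≡⟨ *-comm ⌊ z /2⌋ 2 ⟩
      ⌊ z /2⌋ + (⌊ z /2⌋ + 0) ≡⟨ cong (⌊ z /2⌋ +_) (+-identityʳ ⌊ z /2⌋) ⟩
      ⌊ z /2⌋ + ⌊ z /2⌋       ≤⟨ +-monoʳ-≤ ⌊ z /2⌋ (⌊n/2⌋≤⌈n/2⌉ z) ⟩
      ⌊ z /2⌋ + ⌈ z /2⌉       ≡⟨ ⌊n/2⌋+⌈n/2⌉≡n z ⟩
      z                       ∎
      where open ≤-Reasoning
    bounded : ∀ {z} p p≟m → z < n → block z p p≟m < ⌈ 3 * 3 * n / 2 ⌉
    bounded {z} p (yes _) z<n = <⌈/⌉ (begin-strict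
      (⌊ z /2⌋ + n * 4) * 2     ≡⟨ *-distribʳ-+ 2 ⌊ z /2⌋ (n * 4) ⟩
      ⌊ z /2⌋ * 2 + n * 4 * 2   ≤⟨ +-monoˡ-≤ (n * 4 * 2) (half z) ⟩
      z + n * 4 * 2             <⟨ +-monoˡ-< (n * 4 * 2) z<n ⟩
      n + n * 4 * 2             ≡⟨ cong (n +_) (trans (*-assoc n 4 2) (*-comm n 8)) ⟩
      9 * n                     ∎)
      where open ≤-Reasoning
    bounded {z} p (no p≢m) z<n = <⌈/⌉ (begin-strict
      (Layer.pair z p + z * 4) * 2 <⟨ *-monoˡ-< 2 (ringBlock< p p≢m z<n) ⟩
      n * 4 * 2                    ≡⟨ trans (*-assoc n 4 2) (*-comm n 8) ⟩
      8 * n                        ≤⟨ *-monoˡ-≤ n (n≤1+n 8) ⟩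
      9 * n                        ∎)
      where open ≤-Reasoning
    separates : ∀ {z z′} p q p≟m q≟m → z < n → z′ < n → block z p p≟m ≡ block z′ q q≟m →
                colour z p ≡ colour z′ q → z ≡ z′ × p ≡ q
    separates {z} {z′} p q (yes refl) (yes refl) _ _ eb ec
      with ⌊/2⌋-collision z z′ (+-cancelʳ-≡ (n * 4) _ _ eb)
    ... | inj₁ refl        = refl , refl
    ... | inj₂ (inj₁ refl) = contradiction (sym ec) (centre-changes z′)
    ... | inj₂ (inj₂ refl) = contradiction ec (centre-changes z)
    separates p q (yes _) (no q≢m) _ z′<n eb _ =
      contradiction (sym eb) (<⇒≢ (<-≤-trans (ringBlock< q q≢m z′<n) (m≤n+m (n * 4) _)))
    separates p q (no p≢m) (yes _) z<n _ eb _ =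
      contradiction eb (<⇒≢ (<-≤-trans (ringBlock< p p≢m z<n) (m≤n+m (n * 4) _)))
    separates {z} {z′} p q (no p≢m) (no q≢m) _ _ eb ec
      with a+z*d-injective {z = z} {z′} (Layer.pair<4 z p p≢m) (Layer.pair<4 z′ q q≢m) eb
    ... | refl , same-pair = refl , decidable-stable (p ≟ᶜ q) λ p≢q → Layer.paired z p q p≢m same-pair p≢q ec

arborable-2 : ∀ n → EquitablyListArborable 3 3 n 2
arborable-2 n = layers⇒arborable n 2 λ L two →
  let open Layers L two
  in colour , (λ {z} p _ → Layer.col∈ z p) , rankedLayers n , blocks n

theorem8 : (n₃ k : ℕ) → 2 ≤ k → EquitablyListArborable 3 3 n₃ k
theorem8 n₃ (suc (suc zero))      _ = arborable-2 n₃
theorem8 n₃ k@(suc (suc (suc _))) _ = arborable-≥3 n₃ k (s≤s (s≤s (s≤s z≤n)))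
theorem8 n₃ 1 (s≤s ())
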